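{- Let $M$ be a matroid and $(F,H)$ a non-modular pair of disjoint flats of $M$, where $H$ is a hyperplane of $M$. Then there exists an extension $N$ of $M$ such that for every extension $N'$ of $N$, the pair $(\operatorname{cl}_{N'}(F),\operatorname{cl}_{N'}(H))$ is not a modular pair in $N'$.
   Context: A pair $(X,Y)$ of subsets is modular if $\operatorname{rk}(X)+\operatorname{rk}(Y)=\operatorname{rk}(X\cup Y)+\operatorname{rk}(X\cap Y)$. An extension of a matroid $M$ on $E$ is a matroid $N$ on $F\supseteq E$ with $N|E=M$. -}

module Defs where

open import Data.Nat using (ℕ; suc; _+_; _≤_; _≟_)
open import Data.Fin using (Fin)
open import Data.Fin.Subset using (Subset; _∪_; _∩_; _⊆_; ∣_∣; ⁅_⁆; ⊤; inside; outside)
open import Data.Vec using (_++_; replicate; tabulate)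
open import Relation.Binary.PropositionalEquality using (_≡_)
open import Relation.Nullary using (¬_; yes; no)

record Matroid (n : ℕ) : Set where
  field
    rk        : Subset n → ℕ
    rk-bound  : ∀ X → rk X ≤ ∣ X ∣
    rk-mono   : ∀ X Y → X ⊆ Y → rk X ≤ rk Y
    rk-submod : ∀ X Y → rk (X ∪ Y) + rk (X ∩ Y) ≤ rk X + rk Y

open Matroid public

pad : ∀ {n} k → Subset n → Subset (n + k)
pad k X = X ++ replicate k outside

IsExtension : ∀ {n k} → Matroid n → Matroid (n + k) → Set
IsExtension {n} {k} M N = ∀ (X : Subset n) → rk N (pad k X) ≡ rk M X

cl : ∀ {n} → Matroid n → Subset n → Subset n
cl M X = tabulate λ e → decide (rk M (X ∪ ⁅ e ⁆) ≟ rk M X)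
  where
  decide : ∀ {a b : ℕ} → Relation.Nullary.Dec (a ≡ b) → Data.Fin.Subset.Side
  decide (yes _) = inside
  decide (no _)  = outside

IsFlat : ∀ {n} → Matroid n → Subset n → Set
IsFlat M X = cl M X ≡ X

IsHyperplane : ∀ {n} → Matroid n → Subset n → Set
IsHyperplane M H = IsFlat M H × (suc (rk M H) ≡ rk M ⊤)
  where open import Data.Product using (_×_)

ModularPair : ∀ {n} → Matroid n → Subset n → Subset n → Set
ModularPair M X Y = rk M X + rk M Y ≡ rk M (X ∪ Y) + rk M (X ∩ Y)

{-# OPTIONS --safe #-}

-- Put r F = ε + 2. If (cl F, cl H) were modular in an extension, then L = cl F ∩ cl H would have rank at least ε + 1.
-- As in the Vámos matroid, this is excluded by three further sets A, B, C with the following properties.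
-- F and H are skew after contracting A, which forces L ⊆ cl A. F and A are skew after contracting B, and also
-- after contracting C, which forces L ⊆ cl B and L ⊆ cl C. Finally r B + r C − r (B ∪ C) = ε, so r L ≤ ε.
-- The sets A, B, C are independent, and are adjoined by Higgs lifts: if g is a quotient of f, then min (f, g + c)
-- is again a matroid rank function. A is adjoined along the rank-2 quotient Q of M in which F and H are points,
-- then B and C along a quotient φ₂ of the result φ₁; both fit together because φ₁ ≤ 2 φ₂ + ε.
module Submission where

open import Defs
open import Data.Nat using (ℕ; zero; suc; _+_; _∸_; _⊓_; _≤_; _<_; z≤n; s≤s; _≟_)
open import Data.Fin.Subset
open import Data.Product using (Σ; ∃; _×_; _,_)
open import Relation.Nullary using (¬_; Dec; yes; no; does)
open import Data.Nat.Properties hiding (_≟_)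
open import Algebra.Properties.CommutativeSemigroup +-commutativeSemigroup using (interchange)
open import Data.Bool using (if_then_else_; _∨_)
open import Data.Empty using (⊥-elim)
open import Data.Fin using (zero; suc)
open import Data.Fin.Properties using (any?)
open import Data.Fin.Subset.Properties
open import Data.Nat.Solver using (module +-*-Solver)
open import Data.Sum using (inj₁; inj₂; [_,_]′)
open import Data.Vec using ([]; _∷_; _++_; take; drop; lookup; replicate)
open import Data.Vec.Properties using (lookup∘tabulate; lookup⇒[]=; []=⇒lookup; take++drop≡id;
  take-zipWith; drop-zipWith; ++-injectiveˡ; ++-injectiveʳ; zipWith-++; zipWith-replicate)
open import Function using (_∘_)
open import Relation.Binary.PropositionalEquality
open import Relation.Nullary.Decidable using (_×-dec_; ¬?; decidable-stable)

open +-*-Solver using (solve; _:+_; _:=_; con)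

-- Arithmetic and inclusions of finite subsets.

private variable
  m n k : ℕ

-- Adding a known inequality to the goal turns a linear consequence into an equation free of
-- subtraction, which the semiring solver settles.
lin : ∀ {x y u v} → u ≤ v → x + v ≡ y + u → x ≤ y
lin {x} {y} {u} {v} u≤v eq = +-cancelʳ-≤ u x y (begin
  x + u ≤⟨ +-monoʳ-≤ x u≤v ⟩
  x + v ≡⟨ eq ⟩
  y + u ∎)
  where open ≤-Reasoning

+-interchange-≤ : ∀ a b c d a′ b′ c′ d′ → a + b ≤ c + d → a′ + b′ ≤ c′ + d′
                → a + a′ + (b + b′) ≤ c + c′ + (d + d′)
+-interchange-≤ a b c d a′ b′ c′ d′ h h′ =
  subst₂ _≤_ (interchange a b a′ b′) (interchange c d c′ d′) (+-mono-≤ h h′)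

∪-lub : {X Y Z : Subset n} → X ⊆ Z → Y ⊆ Z → X ∪ Y ⊆ Z
∪-lub {X = X} {Y} X⊆Z Y⊆Z i = [ X⊆Z , Y⊆Z ]′ (x∈p∪q⁻ X Y i)

∪-mono : {X X′ Y Y′ : Subset n} → X ⊆ X′ → Y ⊆ Y′ → X ∪ Y ⊆ X′ ∪ Y′
∪-mono {X′ = X′} {Y′ = Y′} p q = ∪-lub (p⊆p∪q Y′ ∘ p) (q⊆p∪q X′ Y′ ∘ q)

∩-mono : {X X′ Y Y′ : Subset n} → X ⊆ X′ → Y ⊆ Y′ → X ∩ Y ⊆ X′ ∩ Y′
∩-mono {X = X} {Y = Y} p q i = let (a , b) = x∈p∩q⁻ X Y i in x∈p∩q⁺ (p a , q b)

∩-glb : {X Y Z : Subset n} → Z ⊆ X → Z ⊆ Y → Z ⊆ X ∩ Y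
∩-glb p q i = x∈p∩q⁺ (p i , q i)

⊆⇒∪≡ : {X Y : Subset n} → X ⊆ Y → X ∪ Y ≡ Y
⊆⇒∪≡ {X = X} {Y} X⊆Y = ⊆-antisym (∪-lub X⊆Y ⊆-refl) (q⊆p∪q X Y)

⊈⇒∃ : {X Y : Subset n} → ¬ (X ⊆ Y) → ∃ λ x → x ∈ X × x ∉ Y
⊈⇒∃ {X = X} {Y} X⊈Y with any? (λ x → (x ∈? X) ×-dec ¬? (x ∈? Y))
... | yes w = w
... | no none = ⊥-elim (X⊈Y λ {x} x∈X → decidable-stable (x ∈? Y) λ x∉Y → none (x , x∈X , x∉Y))

subset-induction : ∀ {n} (P : Subset n → Set) → P ⊥ → (∀ Y x → P Y → P (Y ∪ ⁅ x ⁆)) → ∀ Y → P Y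
subset-induction P p⊥ step [] = p⊥
subset-induction {suc n} P p⊥ step (b ∷ Y) = last b
  where
  P-out : P (outside ∷ Y)
  P-out = subset-induction (P ∘ (outside ∷_)) p⊥ (λ Z x → step (outside ∷ Z) (suc x)) Y
  last : ∀ b → P (b ∷ Y)
  last outside = P-out
  last inside  = subst (λ Z → P (inside ∷ Z)) (∪-identityʳ Y) (step (outside ∷ Y) zero P-out)

-- Submodular set functions, quotients and minima.

SetFun : ℕ → Set
SetFun n = Subset n → ℕ

infix 4 _≤′_ _↠_
infixl 6 _⊕_
infixl 7 _⊓′_

_⊕_ _⊓′_ : SetFun n → SetFun n → SetFun n
(f ⊕ g) X = f X + g X
(f ⊓′ g) X = f X ⊓ g X

constant : ℕ → SetFun n
constant k _ = k

_≤′_ : SetFun n → SetFun n → Set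
f ≤′ g = ∀ X → f X ≤ g X

record Mono (f : SetFun n) : Set where
  constructor mkMono
  field mono : ∀ X Y → X ⊆ Y → f X ≤ f Y
open Mono

-- Submodularity of a minimum `q` splits into one inequality for each choice of the terms attained
-- at X and at Y; separate `f` and `g` let each choice be proved alone.
record Bound (q f g : SetFun n) : Set where
  constructor mkBound
  field bound : ∀ X Y → q (X ∪ Y) + q (X ∩ Y) ≤ f X + g Y
open Bound

Submodular : SetFun n → Set
Submodular f = Bound f f f

-- f − g is monotone: for matroid rank functions this says that g is a quotient of f.
record _↠_ (f g : SetFun n) : Set where
  constructor mk↠
  field gap : ∀ X Y → X ⊆ Y → g Y + f X ≤ f Y + g X
open _↠_

constant-mono : ∀ k → Mono {n} (constant k)
constant-mono k = mkMono λ _ _ _ → ≤-refl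

constant-submodular : ∀ k → Submodular {n} (constant k)
constant-submodular k = mkBound λ _ _ → ≤-refl

module _ {f g : SetFun n} where

  ⊕-mono : Mono f → Mono g → Mono (f ⊕ g)
  ⊕-mono p q = mkMono λ X Y X⊆Y → +-mono-≤ (mono p X Y X⊆Y) (mono q X Y X⊆Y)

  ⊓-mono : Mono f → Mono g → Mono (f ⊓′ g)
  ⊓-mono p q = mkMono λ X Y X⊆Y → ⊓-mono-≤ (mono p X Y X⊆Y) (mono q X Y X⊆Y)

  ⊕-submodular : Submodular f → Submodular g → Submodular (f ⊕ g)
  ⊕-submodular p q = mkBound λ X Y →
    +-interchange-≤ (f (X ∪ Y)) (f (X ∩ Y)) (f X) (f Y) (g (X ∪ Y)) (g (X ∩ Y)) (g X) (g Y)
      (bound p X Y) (bound q X Y)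

  ↠-trans : {h : SetFun n} → f ↠ g → g ↠ h → f ↠ h
  ↠-trans {h} p q = mk↠ λ X Y X⊆Y →
    lin (+-mono-≤ (gap p X Y X⊆Y) (gap q X Y X⊆Y))
      (solve 6 (λ fX fY gX gY hX hY →
        (hY :+ fX) :+ ((fY :+ gX) :+ (gY :+ hX)) := (fY :+ hX) :+ ((gY :+ fX) :+ (hY :+ gX)))
        refl (f X) (f Y) (g X) (g Y) (h X) (h Y))

  ↠-⊕ : {f′ g′ : SetFun n} → f ↠ g → f′ ↠ g′ → f ⊕ f′ ↠ g ⊕ g′
  ↠-⊕ {f′} {g′} p q = mk↠ λ X Y X⊆Y →
    +-interchange-≤ (g Y) (f X) (f Y) (g X) (g′ Y) (f′ X) (f′ Y) (g′ X)
      (gap p X Y X⊆Y) (gap q X Y X⊆Y)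

  -- Whichever term attains the minimum at X also bounds it at Y, so one of the two gaps suffices.
  ↠-⊓ : {h : SetFun n} → h ↠ f → h ↠ g → h ↠ f ⊓′ g
  ↠-⊓ {h} p q = mk↠ go
    where
    go : ∀ X Y → X ⊆ Y → f Y ⊓ g Y + h X ≤ h Y + f X ⊓ g X
    go X Y X⊆Y with ⊓-sel (f X) (g X)
    ... | inj₁ eq rewrite eq = ≤-trans (+-monoˡ-≤ (h X) (m⊓n≤m (f Y) (g Y))) (gap p X Y X⊆Y)
    ... | inj₂ eq rewrite eq = ≤-trans (+-monoˡ-≤ (h X) (m⊓n≤n (f Y) (g Y))) (gap q X Y X⊆Y)

↠-refl : {f : SetFun n} → f ↠ f
↠-refl = mk↠ λ _ _ _ → ≤-refl

↠-constant : {f : SetFun n} → ∀ k → Mono f → f ↠ constant k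
↠-constant {f = f} k p = mk↠ λ X Y X⊆Y →
  ≤-trans (+-monoʳ-≤ k (mono p X Y X⊆Y)) (≤-reflexive (+-comm k (f Y)))

module _ {q f g : SetFun n} where

  bound-sym : Bound q f g → Bound q g f
  bound-sym p = mkBound λ X Y →
    subst₂ _≤_ (cong₂ _+_ (cong q (∪-comm Y X)) (cong q (∩-comm Y X)))
      (+-comm (f Y) (g X)) (bound p Y X)

  bound-⊓ʳ : {h : SetFun n} → Bound q f g → Bound q f h → Bound q f (g ⊓′ h)
  bound-⊓ʳ {h} p r = mkBound go
    where
    go : ∀ X Y → q (X ∪ Y) + q (X ∩ Y) ≤ f X + g Y ⊓ h Y
    go X Y with ⊓-sel (g Y) (h Y)
    ... | inj₁ eq rewrite eq = bound p X Y
    ... | inj₂ eq rewrite eq = bound r X Y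

  -- Bound `q` by `g` at the union and by `f` at the intersection. From X ∩ Y to X, `f` grows at
  -- least as much as `g`, so submodularity of `g` finishes.
  bound-↠ : q ≤′ f → q ≤′ g → f ↠ g → Submodular g → Bound q f g
  bound-↠ q≤f q≤g f↠g sub = mkBound λ X Y →
    ≤-trans (+-mono-≤ (q≤g (X ∪ Y)) (q≤f (X ∩ Y)))
      (lin (+-mono-≤ (gap f↠g (X ∩ Y) X (p∩q⊆p X Y)) (bound sub X Y))
        (solve 6 (λ fX f∩ gX gY g∪ g∩ →
          (g∪ :+ f∩) :+ ((fX :+ g∩) :+ (gX :+ gY)) := (fX :+ gY) :+ ((gX :+ f∩) :+ (g∪ :+ g∩)))
          refl (f X) (f (X ∩ Y)) (g X) (g Y) (g (X ∪ Y)) (g (X ∩ Y))))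

bound-⊓ : {q f g : SetFun n} → Bound q f f → Bound q f g → Bound q g g → Bound q (f ⊓′ g) (f ⊓′ g)
bound-⊓ ff fg gg =
  bound-⊓ʳ (bound-sym (bound-⊓ʳ ff fg)) (bound-sym (bound-⊓ʳ (bound-sym fg) gg))

bound-self : {q f : SetFun n} → q ≤′ f → Submodular f → Bound q f f
bound-self q≤f = bound-↠ q≤f q≤f ↠-refl

-- This is the Higgs lift, with the added constant absorbed into `g`.
⊓-submodular : {f g : SetFun n} → f ↠ g → Submodular f → Submodular g → Submodular (f ⊓′ g)
⊓-submodular {f = f} {g} f↠g subf subg =
  bound-⊓ (bound-self q≤f subf) (bound-↠ q≤f q≤g f↠g subg) (bound-self q≤g subg)
  where
  q≤f : f ⊓′ g ≤′ f
  q≤f X = m⊓n≤m (f X) (g X)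
  q≤g : f ⊓′ g ≤′ g
  q≤g X = m⊓n≤n (f X) (g X)

-- The pointwise hypothesis is needed only where p₁ ⊓′ p₂ is p₂ at Y and q₁ ⊓′ q₂ is q₁ at X.
↠-⊓⊓ : {p₁ p₂ q₁ q₂ : SetFun n} → p₁ ↠ q₁ → p₂ ↠ q₂ → q₁ ↠ q₂
      → p₁ ⊕ q₂ ≤′ p₂ ⊕ q₁ → p₁ ⊓′ p₂ ↠ q₁ ⊓′ q₂
↠-⊓⊓ {p₁ = p₁} {p₂} {q₁} {q₂} pq₁ pq₂ q₁₂ pw = mk↠ go
  where
  go : ∀ X Y → X ⊆ Y → q₁ Y ⊓ q₂ Y + p₁ X ⊓ p₂ X ≤ p₁ Y ⊓ p₂ Y + q₁ X ⊓ q₂ X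
  go X Y X⊆Y with ⊓-sel (p₁ Y) (p₂ Y) | ⊓-sel (q₁ X) (q₂ X)
  ... | inj₁ e | inj₁ e′ rewrite e | e′ =
    ≤-trans (+-mono-≤ (m⊓n≤m (q₁ Y) (q₂ Y)) (m⊓n≤m (p₁ X) (p₂ X))) (gap pq₁ X Y X⊆Y)
  ... | inj₁ e | inj₂ e′ rewrite e | e′ =
    ≤-trans (+-mono-≤ (m⊓n≤n (q₁ Y) (q₂ Y)) (m⊓n≤m (p₁ X) (p₂ X))) (gap (↠-trans pq₁ q₁₂) X Y X⊆Y)
  ... | inj₂ e | inj₂ e′ rewrite e | e′ =
    ≤-trans (+-mono-≤ (m⊓n≤n (q₁ Y) (q₂ Y)) (m⊓n≤n (p₁ X) (p₂ X))) (gap pq₂ X Y X⊆Y)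
  ... | inj₂ e | inj₁ e′ rewrite e | e′ =
    ≤-trans (+-mono-≤ (m⊓n≤n (q₁ Y) (q₂ Y)) (m⊓n≤m (p₁ X) (p₂ X)))
      (lin (+-mono-≤ (gap pq₂ X Y X⊆Y) (pw X))
        (solve 6 (λ q₂Y p₁X p₂X p₂Y q₂X q₁X →
          (q₂Y :+ p₁X) :+ ((p₂Y :+ q₂X) :+ (p₂X :+ q₁X)) := (p₂Y :+ q₁X) :+ ((q₂Y :+ p₂X) :+ (p₁X :+ q₂X)))
          refl (q₂ Y) (p₁ X) (p₂ X) (p₂ Y) (q₂ X) (q₁ X)))

-- Rank functions of rank at most one, given by their set of loops.

off : Subset n → SetFun n
off A X = if does (X ⊆? A) then 0 else 1

module _ (A : Subset n) where

  off-⊆ : ∀ X → X ⊆ A → off A X ≡ 0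
  off-⊆ X X⊆A with X ⊆? A
  ... | yes _ = refl
  ... | no X⊈A = ⊥-elim (X⊈A X⊆A)

  off-⊈ : ∀ X → ¬ (X ⊆ A) → off A X ≡ 1
  off-⊈ X X⊈A with X ⊆? A
  ... | yes X⊆A = ⊥-elim (X⊈A X⊆A)
  ... | no _ = refl

  off≤1 : ∀ X → off A X ≤ 1
  off≤1 X with X ⊆? A
  ... | yes _ = z≤n
  ... | no _ = s≤s z≤n

  off-mono : Mono (off A)
  off-mono = mkMono go
    where
    go : ∀ X Y → X ⊆ Y → off A X ≤ off A Y
    go X Y X⊆Y with Y ⊆? A
    ... | yes Y⊆A = ≤-reflexive (off-⊆ X (⊆-trans X⊆Y Y⊆A))
    ... | no _ = off≤1 X

  off-submodular : Submodular (off A)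
  off-submodular = mkBound go
    where
    go : ∀ X Y → off A (X ∪ Y) + off A (X ∩ Y) ≤ off A X + off A Y
    go X Y with X ⊆? A | Y ⊆? A
    ... | yes X⊆A | yes Y⊆A =
      ≤-reflexive (cong₂ _+_ (off-⊆ (X ∪ Y) (∪-lub X⊆A Y⊆A)) (off-⊆ (X ∩ Y) (⊆-trans (p∩q⊆p X Y) X⊆A)))
    ... | yes X⊆A | no _ =
      ≤-trans (+-mono-≤ (off≤1 (X ∪ Y)) (≤-reflexive (off-⊆ (X ∩ Y) (⊆-trans (p∩q⊆p X Y) X⊆A)))) ≤-refl
    ... | no _ | yes Y⊆A =
      +-mono-≤ (off≤1 (X ∪ Y)) (≤-reflexive (off-⊆ (X ∩ Y) (⊆-trans (p∩q⊆q X Y) Y⊆A)))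
    ... | no _ | no _ = +-mono-≤ (off≤1 (X ∪ Y)) (off≤1 (X ∩ Y))

-- Span, closure, flats and skew sets.

module Rank (M : Matroid n) where

  rk-Mono : Mono (rk M)
  rk-Mono = mkMono (rk-mono M)

  rk-Submodular : Submodular (rk M)
  rk-Submodular = mkBound (rk-submod M)

  rk-⊥ : rk M ⊥ ≡ 0
  rk-⊥ = n≤0⇒n≡0 (≤-trans (rk-bound M ⊥) (≤-reflexive (∣⊥∣≡0 n)))

  -- The inclusion of L in the closure of A, in terms of rank; the reverse inequality is
  -- monotonicity.
  Spans : Subset n → Subset n → Set
  Spans A L = rk M (A ∪ L) ≤ rk M A

  submod-⊆ : ∀ {P S} X Y → P ⊆ X ∪ Y → S ⊆ X ∩ Y → rk M P + rk M S ≤ rk M X + rk M Y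
  submod-⊆ {P} {S} X Y P⊆ S⊆ =
    ≤-trans (+-mono-≤ (rk-mono M P (X ∪ Y) P⊆) (rk-mono M S (X ∩ Y) S⊆)) (rk-submod M X Y)

  spans-⊇ : ∀ {A B L} → A ⊆ B → Spans A L → Spans B L
  spans-⊇ {A} {B} {L} A⊆B sp = +-cancelʳ-≤ (rk M A) _ _ (≤-trans
    (submod-⊆ B (A ∪ L) (∪-mono ⊆-refl (q⊆p∪q A L)) (∩-glb A⊆B (p⊆p∪q L)))
    (+-monoʳ-≤ (rk M B) sp))

  spans-⊆ : ∀ {A K L} → K ⊆ L → Spans A L → Spans A K
  spans-⊆ {A} {K} {L} K⊆L sp = ≤-trans (rk-mono M (A ∪ K) (A ∪ L) (∪-mono ⊆-refl K⊆L)) sp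

  -- Submodularity of A ∪ K and A ∪ L, whose intersection contains A.
  spans-∪ : ∀ {A K L} → Spans A K → Spans A L → Spans A (K ∪ L)
  spans-∪ {A} {K} {L} sK sL = +-cancelʳ-≤ (rk M A) _ _ (≤-trans
    (submod-⊆ (A ∪ K) (A ∪ L)
      (∪-lub (p⊆p∪q (A ∪ L) ∘ p⊆p∪q K) (∪-mono (q⊆p∪q A K) (q⊆p∪q A L)))
      (∩-glb (p⊆p∪q K) (p⊆p∪q L)))
    (+-mono-≤ sK sL))

  ∈cl⁻ : ∀ X x → x ∈ cl M X → Spans X ⁅ x ⁆
  ∈cl⁻ X x x∈ with rk M (X ∪ ⁅ x ⁆) ≟ rk M X | trans (sym (lookup∘tabulate _ x)) ([]=⇒lookup x∈)
  ... | yes same | _ = ≤-reflexive same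
  ... | no _ | ()

  ∈cl⁺ : ∀ X x → Spans X ⁅ x ⁆ → x ∈ cl M X
  ∈cl⁺ X x sp with lookup (cl M X) x in e
  ... | inside = lookup⇒[]= x (cl M X) e
  ... | outside with rk M (X ∪ ⁅ x ⁆) ≟ rk M X | trans (sym (lookup∘tabulate _ x)) e
  ... | yes _ | ()
  ... | no neq | _ = ⊥-elim (neq (≤-antisym sp (rk-mono M X (X ∪ ⁅ x ⁆) (p⊆p∪q ⁅ x ⁆))))

  ⊆cl : ∀ X → X ⊆ cl M X
  ⊆cl X {x} x∈X = ∈cl⁺ X x (rk-mono M (X ∪ ⁅ x ⁆) X (∪-lub ⊆-refl λ y∈ → subst (_∈ X) (sym (x∈⁅y⁆⇒x≡y x y∈)) x∈X))

  cl-spans : ∀ X → Spans X (cl M X)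
  -- The inclusion sits inside the predicate, so every element inserted is known to lie in the
  -- closure.
  cl-spans X = subset-induction (λ Y → Y ⊆ cl M X → Spans X Y)
    (λ _ → ≤-reflexive (cong (rk M) (∪-identityʳ X)))
    (λ Y x ih Y∪x⊆ → spans-∪ (ih (Y∪x⊆ ∘ p⊆p∪q ⁅ x ⁆)) (∈cl⁻ X x (Y∪x⊆ (q⊆p∪q Y ⁅ x ⁆ (x∈⁅x⁆ x)))))
    (cl M X) ⊆-refl

  flat-< : ∀ {A X Y} → IsFlat M A → X ⊆ A → ¬ (Y ⊆ A) → X ⊆ Y → rk M X < rk M Y
  flat-< {A} {X} {Y} flat X⊆A Y⊈A X⊆Y = let (y , y∈Y , y∉A) = ⊈⇒∃ Y⊈A in
    ≰⇒> λ rY≤rX → y∉A (subst (y ∈_) flat (∈cl⁺ A y (spans-⊇ X⊆A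
      (≤-trans (rk-mono M (X ∪ ⁅ y ⁆) Y (∪-lub X⊆Y λ z∈ → subst (_∈ Y) (sym (x∈⁅y⁆⇒x≡y y z∈)) y∈Y)) rY≤rX))))

  -- `off A` rises only on leaving the flat A, and there the rank of M rises too by `flat-<`.
  flat-↠ : ∀ {A} → IsFlat M A → rk M ↠ off A
  flat-↠ {A} flat = mk↠ go
    where
    go : ∀ X Y → X ⊆ Y → off A Y + rk M X ≤ rk M Y + off A X
    go X Y X⊆Y with X ⊆? A | Y ⊆? A
    ... | yes X⊆A | no Y⊈A = ≤-trans (flat-< flat X⊆A Y⊈A X⊆Y) (≤-reflexive (sym (+-identityʳ _)))
    ... | yes _ | yes _ = ≤-trans (rk-mono M X Y X⊆Y) (≤-reflexive (sym (+-identityʳ _)))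
    ... | no X⊈A | yes Y⊆A = ⊥-elim (X⊈A (⊆-trans X⊆Y Y⊆A))
    ... | no _ | no _ = ≤-trans (+-monoʳ-≤ 1 (rk-mono M X Y X⊆Y)) (≤-reflexive (+-comm 1 _))

  -- If `t` is the rank of C, the numerical hypothesis says that A and B are skew after contracting
  -- C, so a set spanned by both becomes a set of loops there. A general `t` also serves the final
  -- bound, where C is empty.
  skew : ∀ {A B C L p q s t} → Spans A L → Spans B L → rk M (A ∪ C) ≤ p → rk M (B ∪ C) ≤ q
       → s ≤ rk M ((A ∪ B) ∪ C) → p + q ≤ s + t → rk M (C ∪ L) ≤ t
  skew {A} {B} {C} {L} {p} {q} {s} {t} sA sB rA rB rABC pq = +-cancelˡ-≤ s _ _ (begin
    s + rk M (C ∪ L)                              ≤⟨ +-monoˡ-≤ _ rABC ⟩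
    rk M ((A ∪ B) ∪ C) + rk M (C ∪ L)             ≤⟨ submod-⊆ ((A ∪ C) ∪ L) ((B ∪ C) ∪ L) P⊆ S⊆ ⟩
    rk M ((A ∪ C) ∪ L) + rk M ((B ∪ C) ∪ L)       ≤⟨ +-mono-≤ (spans-⊇ (p⊆p∪q C) sA) (spans-⊇ (p⊆p∪q C) sB) ⟩
    rk M (A ∪ C) + rk M (B ∪ C)                   ≤⟨ +-mono-≤ rA rB ⟩
    p + q                                         ≤⟨ pq ⟩
    s + t                                         ∎)
    where
    open ≤-Reasoning
    P⊆ : (A ∪ B) ∪ C ⊆ ((A ∪ C) ∪ L) ∪ ((B ∪ C) ∪ L)
    P⊆ = ∪-lub (∪-mono (p⊆p∪q L ∘ p⊆p∪q C) (p⊆p∪q L ∘ p⊆p∪q C))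
               (p⊆p∪q _ ∘ p⊆p∪q L ∘ q⊆p∪q A C)
    S⊆ : C ∪ L ⊆ ((A ∪ C) ∪ L) ∩ ((B ∪ C) ∪ L)
    S⊆ = ∩-glb (∪-mono (q⊆p∪q A C) ⊆-refl) (∪-mono (q⊆p∪q B C) ⊆-refl)

-- The quotients of M along which the new sets are adjoined.

module Quotients {n} (M : Matroid n) (F H : Subset n) (flatF : IsFlat M F) (flatH : IsFlat M H)
                 (disjoint : Empty (F ∩ H)) (ε : ℕ) (rkF : rk M F ≡ 2 + ε) where

  open Rank M

  -- This is r F - 1, the number of points to contract so that F is left with rank one.
  e : ℕ
  e = suc ε

  ∅ : Subset n
  ∅ = ⊥

  r Q u w q̂ : SetFun n
  r = rk M
  -- The rank-2 quotient of M whose points are F, H and the parallel classes of M outside F ∪ H.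
  Q = (r ⊓′ constant 2) ⊓′ ((off F ⊕ constant 1) ⊓′ (off H ⊕ constant 1))
  -- The rank-1 quotient in which all elements are parallel.
  u = off ∅
  -- The rank in the contraction of F, plus one. Since r F = 1 + e, the subtraction never truncates.
  w X = r (X ∪ F) ∸ e
  -- The contraction of e points placed freely in F.
  q̂ = r ⊓′ w

  u-∅ : u ∅ ≡ 0
  u-∅ = off-⊆ ∅ ∅ ⊆-refl

  r≤0 : ∀ {X} → X ⊆ ∅ → r X ≤ 0
  r≤0 {X} X⊆∅ = ≤-trans (rk-mono M X ∅ X⊆∅) (≤-reflexive rk-⊥)

  ∩⊆∅ : F ∩ H ⊆ ∅
  ∩⊆∅ i = ⊥-elim (disjoint (_ , i))

  -- A loop lies in every flat, hence in both F and H, which are disjoint.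
  loopless : ∀ X → ¬ (X ⊆ ∅) → 1 ≤ r X
  loopless X X⊈∅ = let (x , x∈X , _) = ⊈⇒∃ X⊈∅ in
    ≰⇒> λ rX≤0 → disjoint (x , x∈p∩q⁺ (loop∈ flatF x∈X rX≤0 , loop∈ flatH x∈X rX≤0))
    where
    loop∈ : ∀ {A x} → IsFlat M A → x ∈ X → r X ≤ 0 → x ∈ A
    loop∈ {A} {x} flat x∈X rX≤0 = subst (x ∈_) flat (∈cl⁺ A x (spans-⊇ (⊆-min A) (begin
      r (∅ ∪ ⁅ x ⁆)  ≤⟨ rk-mono M _ X (∪-lub (⊆-min X) λ i → subst (_∈ X) (sym (x∈⁅y⁆⇒x≡y x i)) x∈X) ⟩
      r X            ≤⟨ rX≤0 ⟩
      0              ≤⟨ z≤n ⟩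
      r ∅            ∎)))
      where open ≤-Reasoning

  Q≤r : Q ≤′ r
  Q≤r X = ≤-trans (m⊓n≤m _ _) (m⊓n≤m _ _)

  Q≤2 : Q ≤′ constant 2
  Q≤2 X = ≤-trans (m⊓n≤m (r X ⊓ 2) _) (m⊓n≤n (r X) 2)

  Q≤F : Q ≤′ off F ⊕ constant 1
  Q≤F X = ≤-trans (m⊓n≤n (r X ⊓ 2) _) (m⊓n≤m _ _)

  Q≤H : Q ≤′ off H ⊕ constant 1
  Q≤H X = ≤-trans (m⊓n≤n (r X ⊓ 2) _) (m⊓n≤n (off F X + 1) _)

  off+1-mono : ∀ (A : Subset n) → Mono (off A ⊕ constant 1)
  off+1-mono A = ⊕-mono (off-mono A) (constant-mono 1)

  off+1-submodular : ∀ (A : Subset n) → Submodular (off A ⊕ constant 1)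
  off+1-submodular A = ⊕-submodular (off-submodular A) (constant-submodular 1)

  Q-mono : Mono Q
  Q-mono = ⊓-mono (⊓-mono rk-Mono (constant-mono 2)) (⊓-mono (off+1-mono F) (off+1-mono H))

  ↠off+1 : ∀ {A} → IsFlat M A → r ↠ off A ⊕ constant 1
  ↠off+1 {A} flat = mk↠ λ X Y X⊆Y → lin (gap (flat-↠ flat) X Y X⊆Y)
    (solve 5 (λ one oX oY rX rY → ((oY :+ one) :+ rX) :+ (rY :+ oX) := (rY :+ (oX :+ one)) :+ (oY :+ rX))
      refl 1 (off A X) (off A Y) (r X) (r Y))

  r↠Q : r ↠ Q
  r↠Q = ↠-⊓ (↠-⊓ ↠-refl (↠-constant 2 rk-Mono)) (↠-⊓ (↠off+1 flatF) (↠off+1 flatH))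

  -- Among the four terms of Q, every pair is related by a quotient except the two coming from F and
  -- H; these are treated in `cross`.
  Q-submodular : Submodular Q
  Q-submodular = bound-⊓
    (bound-⊓ (bound-self Q≤r rk-Submodular) (bound-↠ Q≤r Q≤2 (↠-constant 2 rk-Mono) (constant-submodular 2))
      (bound-self Q≤2 (constant-submodular 2)))
    (bound-⊓ʳ (mixed F flatF Q≤F) (mixed H flatH Q≤H))
    (bound-⊓ (bound-self Q≤F (off+1-submodular F)) (mkBound cross) (bound-self Q≤H (off+1-submodular H)))
    where
    mixed : ∀ A → IsFlat M A → Q ≤′ off A ⊕ constant 1 → Bound Q (r ⊓′ constant 2) (off A ⊕ constant 1)
    mixed A flat Q≤A = bound-sym (bound-⊓ʳ
      (bound-sym (bound-↠ Q≤r Q≤A (↠off+1 flat) (off+1-submodular A)))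
      (bound-↠ Q≤A Q≤2 (↠-constant 2 (off+1-mono A)) (constant-submodular 2)))
    -- If X ⊆ F and Y ⊆ H, then X ∩ Y is empty and Q vanishes there. Otherwise one summand on the
    -- right is 2 and bounds Q at the union, while the other bounds Q at the intersection.
    cross : ∀ X Y → Q (X ∪ Y) + Q (X ∩ Y) ≤ (off F X + 1) + (off H Y + 1)
    cross X Y = go (X ⊆? F) (Y ⊆? H)
      where
      go : Dec (X ⊆ F) → Dec (Y ⊆ H) → Q (X ∪ Y) + Q (X ∩ Y) ≤ (off F X + 1) + (off H Y + 1)
      go (yes X⊆F) (yes Y⊆H) rewrite off-⊆ F X X⊆F | off-⊆ H Y Y⊆H =
        +-mono-≤ (Q≤2 (X ∪ Y)) (≤-trans (Q≤r (X ∩ Y)) (r≤0 (⊆-trans (∩-mono X⊆F Y⊆H) ∩⊆∅)))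
      go (no X⊈F) _ rewrite off-⊈ F X X⊈F =
        +-mono-≤ (Q≤2 (X ∪ Y)) (≤-trans (Q≤H (X ∩ Y)) (mono (off+1-mono H) (X ∩ Y) Y (p∩q⊆q X Y)))
      go (yes _) (no Y⊈H) rewrite off-⊈ H Y Y⊈H =
        ≤-trans (+-mono-≤ (Q≤2 (X ∪ Y)) (≤-trans (Q≤F (X ∩ Y)) (mono (off+1-mono F) (X ∩ Y) X (p∩q⊆p X Y))))
          (≤-reflexive (+-comm 2 (off F X + 1)))

  ↠u : ∀ {g} → Mono g → g ≤′ r → (∀ X → ¬ (X ⊆ ∅) → 1 ≤ g X) → g ↠ u
  ↠u {g} g-mono g≤r g≥1 = mk↠ λ X Y X⊆Y → go X Y X⊆Y (X ⊆? ∅) (Y ⊆? ∅)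
    where
    go : ∀ X Y → X ⊆ Y → Dec (X ⊆ ∅) → Dec (Y ⊆ ∅) → u Y + g X ≤ g Y + u X
    go X Y X⊆Y (no X⊈∅) _ rewrite off-⊈ ∅ X X⊈∅ =
      ≤-trans (+-mono-≤ (off≤1 ∅ Y) (mono g-mono X Y X⊆Y)) (≤-reflexive (+-comm 1 (g Y)))
    go X Y X⊆Y (yes _) (yes Y⊆∅) rewrite off-⊆ ∅ Y Y⊆∅ = ≤-trans (mono g-mono X Y X⊆Y) (m≤m+n (g Y) (u X))
    go X Y X⊆Y (yes X⊆∅) (no Y⊈∅) = ≤-trans
      (+-mono-≤ (off≤1 ∅ Y) (≤-trans (g≤r X) (r≤0 X⊆∅)))
      (≤-trans (g≥1 Y Y⊈∅) (m≤m+n (g Y) (u X)))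

  Q≥1 : ∀ X → ¬ (X ⊆ ∅) → 1 ≤ Q X
  Q≥1 X X⊈∅ = ⊓-glb (⊓-glb (loopless X X⊈∅) (s≤s z≤n)) (⊓-glb (m≤n+m 1 (off F X)) (m≤n+m 1 (off H X)))

  Q↠u : Q ↠ u
  Q↠u = ↠u Q-mono Q≤r Q≥1

  u≤Q : u ≤′ Q
  u≤Q X = go (X ⊆? ∅)
    where
    go : Dec (X ⊆ ∅) → u X ≤ Q X
    go (yes X⊆∅) = ≤-trans (≤-reflexive (off-⊆ ∅ X X⊆∅)) z≤n
    go (no X⊈∅) = ≤-trans (off≤1 ∅ X) (Q≥1 X X⊈∅)

  Q≤u+u : Q ≤′ u ⊕ u
  Q≤u+u X = go (X ⊆? ∅)
    where
    go : Dec (X ⊆ ∅) → Q X ≤ u X + u X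
    go (yes X⊆∅) = ≤-trans (Q≤r X) (≤-trans (r≤0 X⊆∅) z≤n)
    go (no X⊈∅) rewrite off-⊈ ∅ X X⊈∅ = Q≤2 X

  rkF≤ : ∀ X → suc e ≤ r (X ∪ F)
  rkF≤ X = ≤-trans (≤-reflexive (sym rkF)) (rk-mono M F (X ∪ F) (q⊆p∪q X F))

  w+e : ∀ X → w X + e ≡ r (X ∪ F)
  w+e X = m∸n+n≡m (<⇒≤ (rkF≤ X))

  w≥1 : ∀ X → 1 ≤ w X
  w≥1 X = m<n⇒0<n∸m (rkF≤ X)

  w-mono : Mono w
  w-mono = mkMono λ X Y X⊆Y → ∸-monoˡ-≤ e (rk-mono M (X ∪ F) (Y ∪ F) (∪-mono X⊆Y ⊆-refl))

  w-submodular : Submodular w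
  w-submodular = mkBound λ X Y →
    +-cancelʳ-≤ (e + e) _ _ (subst₂ _≤_ (shift (X ∪ Y) (X ∩ Y)) (shift X Y)
      (submod-⊆ (X ∪ F) (Y ∪ F)
        (∪-lub (∪-mono (p⊆p∪q F) (p⊆p∪q F)) (p⊆p∪q _ ∘ q⊆p∪q X F))
        (∩-glb (∪-mono (p∩q⊆p X Y) ⊆-refl) (∪-mono (p∩q⊆q X Y) ⊆-refl))))
    where
    shift : ∀ X Y → r (X ∪ F) + r (Y ∪ F) ≡ w X + w Y + (e + e)
    shift X Y = trans (sym (cong₂ _+_ (w+e X) (w+e Y))) (interchange (w X) e (w Y) e)

  -- Submodularity of Y and X ∪ F, with `e` added to both sides to clear the subtraction.
  r↠w : r ↠ w
  r↠w = mk↠ λ X Y X⊆Y → +-cancelʳ-≤ e _ _ (subst₂ _≤_ (left X Y) (right X Y)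
    (submod-⊆ Y (X ∪ F)
      (∪-mono ⊆-refl (q⊆p∪q X F)) (∩-glb X⊆Y (p⊆p∪q F))))
    where
    left : ∀ X Y → r (Y ∪ F) + r X ≡ w Y + r X + e
    left X Y = trans (cong (_+ r X) (sym (w+e Y)))
      (solve 3 (λ a b c → (a :+ b) :+ c := (a :+ c) :+ b) refl (w Y) e (r X))
    right : ∀ X Y → r Y + r (X ∪ F) ≡ r Y + w X + e
    right X Y = trans (cong (r Y +_) (sym (w+e X))) (sym (+-assoc (r Y) (w X) e))

  q̂-mono : Mono q̂
  q̂-mono = ⊓-mono rk-Mono w-mono

  q̂-submodular : Submodular q̂
  q̂-submodular = ⊓-submodular r↠w rk-Submodular w-submodular

  r↠q̂ : r ↠ q̂
  r↠q̂ = ↠-⊓ ↠-refl r↠w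

  q̂≥1 : ∀ X → ¬ (X ⊆ ∅) → 1 ≤ q̂ X
  q̂≥1 X X⊈∅ = ⊓-glb (loopless X X⊈∅) (w≥1 X)

  q̂↠u : q̂ ↠ u
  q̂↠u = ↠u q̂-mono (λ X → m⊓n≤m (r X) (w X)) q̂≥1

  r≤w+e : r ≤′ w ⊕ constant e
  r≤w+e X = ≤-trans (rk-mono M X (X ∪ F) (p⊆p∪q F)) (≤-reflexive (sym (w+e X)))

  r≤q̂+e : r ≤′ q̂ ⊕ constant e
  r≤q̂+e X with ⊓-sel (r X) (w X)
  ... | inj₁ eq rewrite eq = m≤m+n (r X) e
  ... | inj₂ eq rewrite eq = r≤w+e X

  -- Where `q̂` equals `w`, the loss is at most e = 1 + ε, and the second copy of `w` pays for the
  -- 1.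
  r≤q̂+q̂+ε : r ≤′ q̂ ⊕ q̂ ⊕ constant ε
  r≤q̂+q̂+ε X with ⊓-sel (r X) (w X)
  ... | inj₁ eq rewrite eq = ≤-trans (m≤m+n (r X) (r X)) (m≤m+n (r X + r X) ε)
  ... | inj₂ eq rewrite eq = begin
    r X               ≤⟨ r≤w+e X ⟩
    w X + (1 + ε)     ≡⟨ sym (+-assoc (w X) 1 ε) ⟩
    w X + 1 + ε       ≤⟨ +-monoˡ-≤ ε (+-monoʳ-≤ (w X) (w≥1 X)) ⟩
    w X + w X + ε     ∎
    where open ≤-Reasoning

  F⊈∅ : ¬ (F ⊆ ∅)
  F⊈∅ F⊆∅ = <⇒≱ (s≤s z≤n) (≤-trans (≤-reflexive (sym rkF)) (r≤0 F⊆∅))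

  q̂F≤1 : q̂ F ≤ 1
  q̂F≤1 = ≤-trans (m⊓n≤n (r F) (w F)) (+-cancelʳ-≤ e (w F) 1 (≤-reflexive
    (trans (w+e F) (trans (cong r (∪-idem F)) rkF))))

  QF≤1 : Q F ≤ 1
  QF≤1 = ≤-trans (Q≤F F) (≤-reflexive (cong (_+ 1) (off-⊆ F F ⊆-refl)))

  QH≤1 : Q H ≤ 1
  QH≤1 = ≤-trans (Q≤H H) (≤-reflexive (cong (_+ 1) (off-⊆ H H ⊆-refl)))

  -- F and H are nonempty and disjoint, so F ∪ H lies in neither of them and no term of Q falls
  -- below 2.
  QFH≥2 : ¬ (H ⊆ ∅) → 2 ≤ Q (F ∪ H)
  QFH≥2 H⊈∅ = ⊓-glb
    (⊓-glb (≤-trans (s≤s (s≤s z≤n)) (≤-trans (≤-reflexive (sym rkF)) (rk-mono M F (F ∪ H) (p⊆p∪q H)))) ≤-refl)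
    (⊓-glb (≤-reflexive (cong (_+ 1) (sym (off-⊈ F (F ∪ H) FH⊈F))))
           (≤-reflexive (cong (_+ 1) (sym (off-⊈ H (F ∪ H) FH⊈H)))))
    where
    FH⊈F : ¬ (F ∪ H ⊆ F)
    FH⊈F p = H⊈∅ (∩⊆∅ ∘ ∩-glb (p ∘ q⊆p∪q F H) ⊆-refl)
    FH⊈H : ¬ (F ∪ H ⊆ H)
    FH⊈H p = F⊈∅ (∩⊆∅ ∘ ∩-glb ⊆-refl (p ∘ p⊆p∪q H))

-- Pulling set functions back along projections of the ground set.

record SetHom (φ : Subset m → Subset n) : Set where
  field
    ∪-homo : ∀ X Y → φ (X ∪ Y) ≡ φ X ∪ φ Y
    ∩-homo : ∀ X Y → φ (X ∩ Y) ≡ φ X ∩ φ Y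
open SetHom

take-hom : ∀ n → SetHom {n + k} (take n)
take-hom n = record
  { ∪-homo = take-zipWith {m = n} _ ; ∩-homo = take-zipWith {m = n} _ }

drop-hom : ∀ n → SetHom {n + k} (drop n)
drop-hom n = record
  { ∪-homo = drop-zipWith {m = n} _ ; ∩-homo = drop-zipWith {m = n} _ }

∘-hom : ∀ {l} {ψ : Subset n → Subset k} {φ : Subset l → Subset n} → SetHom ψ → SetHom φ → SetHom (ψ ∘ φ)
∘-hom {ψ = ψ} {φ} p q = record
  { ∪-homo = λ X Y → trans (cong ψ (∪-homo q X Y)) (∪-homo p (φ X) (φ Y))
  ; ∩-homo = λ X Y → trans (cong ψ (∩-homo q X Y)) (∩-homo p (φ X) (φ Y)) }

infixr 8 _⟦_⟧
_⟦_⟧ : SetFun n → (Subset m → Subset n) → SetFun m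
(f ⟦ φ ⟧) X = f (φ X)

module _ {φ : Subset m → Subset n} (hom : SetHom φ) where

  -- Inclusion amounts to the equation X ∪ Y ≡ Y, which φ preserves.
  hom-⊆ : ∀ {X Y} → X ⊆ Y → φ X ⊆ φ Y
  hom-⊆ {X} {Y} X⊆Y i = subst (_ ∈_)
    (trans (sym (∪-homo hom X Y)) (cong φ (⊆⇒∪≡ X⊆Y))) (p⊆p∪q (φ Y) i)

  ⟦⟧-mono : {f : SetFun n} → Mono f → Mono (f ⟦ φ ⟧)
  ⟦⟧-mono p = mkMono λ X Y X⊆Y → mono p (φ X) (φ Y) (hom-⊆ X⊆Y)

  ⟦⟧-submodular : {f : SetFun n} → Submodular f → Submodular (f ⟦ φ ⟧)
  ⟦⟧-submodular {f} p = mkBound λ X Y → ≤-trans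
    (≤-reflexive (cong₂ _+_ (cong f (∪-homo hom X Y)) (cong f (∩-homo hom X Y))))
    (bound p (φ X) (φ Y))

  ⟦⟧-↠ : {f g : SetFun n} → f ↠ g → f ⟦ φ ⟧ ↠ g ⟦ φ ⟧
  ⟦⟧-↠ p = mk↠ λ X Y X⊆Y → gap p (φ X) (φ Y) (hom-⊆ X⊆Y)

-- Cardinality and concatenation of subsets.

∣∣-mono : Mono {n} ∣_∣
∣∣-mono = mkMono λ _ _ → p⊆q⇒∣p∣≤∣q∣

∣∣-submodular : Submodular {n} ∣_∣
∣∣-submodular = mkBound λ X Y → ≤-reflexive (go X Y)
  where
  go : ∀ {n} (X Y : Subset n) → ∣ X ∪ Y ∣ + ∣ X ∩ Y ∣ ≡ ∣ X ∣ + ∣ Y ∣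
  go [] [] = refl
  go (outside ∷ X) (outside ∷ Y) = go X Y
  go (outside ∷ X) (inside  ∷ Y) = trans (cong suc (go X Y)) (sym (+-suc ∣ X ∣ ∣ Y ∣))
  go (inside  ∷ X) (outside ∷ Y) = cong suc (go X Y)
  go (inside  ∷ X) (inside  ∷ Y) =
    cong suc (trans (+-suc _ _) (trans (cong suc (go X Y)) (sym (+-suc ∣ X ∣ ∣ Y ∣))))

∣++∣ : ∀ (X : Subset m) (Y : Subset n) → ∣ X ++ Y ∣ ≡ ∣ X ∣ + ∣ Y ∣
∣++∣ [] Y = refl
∣++∣ (outside ∷ X) Y = ∣++∣ X Y
∣++∣ (inside  ∷ X) Y = cong suc (∣++∣ X Y)

∣take∣+∣drop∣ : ∀ m (Z : Subset (m + n)) → ∣ Z ∣ ≡ ∣ take m Z ∣ + ∣ drop m Z ∣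
∣take∣+∣drop∣ m Z = trans (cong ∣_∣ (sym (take++drop≡id m Z))) (∣++∣ (take m Z) (drop m Z))

take-++ : ∀ (X : Subset m) (Y : Subset n) → take m (X ++ Y) ≡ X
take-++ {m} X Y = ++-injectiveˡ (take m (X ++ Y)) X (take++drop≡id m (X ++ Y))

drop-++ : ∀ (X : Subset m) (Y : Subset n) → drop m (X ++ Y) ≡ Y
drop-++ {m} X Y = ++-injectiveʳ (take m (X ++ Y)) X (take++drop≡id m (X ++ Y))

⊥-++ : ∀ m → ⊥ {m} ++ ⊥ {n} ≡ ⊥
⊥-++ zero = refl
⊥-++ (suc m) = cong (outside ∷_) (⊥-++ m)

∪-++ : ∀ (X : Subset m) (Y : Subset n) X′ Y′ → (X ++ Y) ∪ (X′ ++ Y′) ≡ (X ∪ X′) ++ (Y ∪ Y′)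
∪-++ X Y X′ Y′ = zipWith-++ _∨_ X Y X′ Y′

∪-replicate : ∀ k s t → replicate k s ∪ replicate k t ≡ replicate k (s ∨ t)
∪-replicate k s t = zipWith-replicate {n = k} _∨_ s t

pad-∪ : ∀ k (X Y : Subset n) → pad k X ∪ pad k Y ≡ pad k (X ∪ Y)
pad-∪ k X Y = trans (∪-++ X ⊥ Y ⊥) (cong ((X ∪ Y) ++_) (∪-idem ⊥))

-- The extension N by the independent sets A, B and C.

module Construction {n} (M : Matroid n) (F H : Subset n) (flatF : IsFlat M F) (flatH : IsFlat M H)
                    (disjoint : Empty (F ∩ H)) (ε : ℕ) (rkF : rk M F ≡ 2 + ε) (H⊈⊥ : ¬ (H ⊆ ⊥)) where

  open Rank M
  open Quotients M F H flatF flatH disjoint ε rkF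

  -- A has `c` elements, B and C have `d` each, and `b` bounds the rank of A after contracting B or
  -- C. The choice `c = b + e` makes `φ₁↠φ₂` work, `b = suc n` ensures b ≥ 1 and c ≥ n, and `K` is
  -- 2d - ε.
  b c d K : ℕ
  b = suc n
  c = b + e
  d = ε + (c + 2)
  K = d + (c + 2)

  size : ℕ
  size = n + (c + (d + d))

  block : Subset n → Subset c → Subset d → Subset d → Subset size
  block X A B C = X ++ (A ++ (B ++ C))

  πE : Subset size → Subset n
  πE Z = take n Z
  πA : Subset size → Subset c
  πA Z = take c (drop n Z)
  πB πC : Subset size → Subset d
  πB Z = take d (drop c (drop n Z))
  πC Z = drop d (drop c (drop n Z))

  πE-hom : SetHom πE
  πE-hom = take-hom n
  πA-hom : SetHom πA
  πA-hom = ∘-hom (take-hom c) (drop-hom n)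
  πB-hom : SetHom πB
  πB-hom = ∘-hom (take-hom d) (∘-hom (drop-hom c) (drop-hom n))
  πC-hom : SetHom πC
  πC-hom = ∘-hom (drop-hom d) (∘-hom (drop-hom c) (drop-hom n))

  -- The values of `φ₁` and `φ₂`, in which A enters only through the number `i` of its elements
  -- present.
  f₁ f₂ : Subset n → ℕ → ℕ
  f₁ X i = (r X + i) ⊓ (Q X + c)
  f₂ X i = (q̂ X + i) ⊓ (u X + b)

  -- The second and third terms come from lifting along `φ₂` by B and by C; the cap `K` makes B ∪ C
  -- fall short of rank 2d by ε.
  ρ : Subset n → ℕ → ℕ → ℕ → ℕ
  ρ X i j k = ((f₁ X i + (j + k)) ⊓ (f₂ X i + (d + k))) ⊓ ((f₂ X i + (j + d)) ⊓ K)

  α β γ : SetFun size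
  α = ∣_∣ ⟦ πA ⟧
  β = ∣_∣ ⟦ πB ⟧
  γ = ∣_∣ ⟦ πC ⟧

  φ₁ φ₂ ρ₁₁ ρ₁₂ ρ₂₁ ρN : SetFun size
  φ₁ = (r ⟦ πE ⟧ ⊕ α) ⊓′ (Q ⟦ πE ⟧ ⊕ constant c)
  φ₂ = (q̂ ⟦ πE ⟧ ⊕ α) ⊓′ (u ⟦ πE ⟧ ⊕ constant b)
  ρ₁₁ = φ₁ ⊕ (β ⊕ γ)
  ρ₁₂ = φ₂ ⊕ (constant d ⊕ γ)
  ρ₂₁ = φ₂ ⊕ (β ⊕ constant d)
  ρN Z = ρ (πE Z) (α Z) (β Z) (γ Z)

  α-mono : Mono α
  α-mono = ⟦⟧-mono πA-hom ∣∣-mono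
  β-mono : Mono β
  β-mono = ⟦⟧-mono πB-hom ∣∣-mono
  γ-mono : Mono γ
  γ-mono = ⟦⟧-mono πC-hom ∣∣-mono
  α-submodular : Submodular α
  α-submodular = ⟦⟧-submodular πA-hom ∣∣-submodular
  β-submodular : Submodular β
  β-submodular = ⟦⟧-submodular πB-hom ∣∣-submodular
  γ-submodular : Submodular γ
  γ-submodular = ⟦⟧-submodular πC-hom ∣∣-submodular

  φ₁-mono : Mono φ₁
  φ₁-mono = ⊓-mono (⊕-mono (⟦⟧-mono πE-hom rk-Mono) α-mono)
                   (⊕-mono (⟦⟧-mono πE-hom Q-mono) (constant-mono c))

  φ₂-mono : Mono φ₂
  φ₂-mono = ⊓-mono (⊕-mono (⟦⟧-mono πE-hom q̂-mono) α-mono)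
                   (⊕-mono (⟦⟧-mono πE-hom (off-mono ∅)) (constant-mono b))

  φ₁-submodular : Submodular φ₁
  φ₁-submodular = ⊓-submodular (↠-⊕ (⟦⟧-↠ πE-hom r↠Q) (↠-constant c α-mono))
    (⊕-submodular (⟦⟧-submodular πE-hom rk-Submodular) α-submodular)
    (⊕-submodular (⟦⟧-submodular πE-hom Q-submodular) (constant-submodular c))

  φ₂-submodular : Submodular φ₂
  φ₂-submodular = ⊓-submodular (↠-⊕ (⟦⟧-↠ πE-hom q̂↠u) (↠-constant b α-mono))
    (⊕-submodular (⟦⟧-submodular πE-hom q̂-submodular) α-submodular)
    (⊕-submodular (⟦⟧-submodular πE-hom (off-submodular ∅)) (constant-submodular b))

  φ₁↠φ₂ : φ₁ ↠ φ₂
  φ₁↠φ₂ = ↠-⊓⊓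
    (↠-⊕ (⟦⟧-↠ πE-hom r↠q̂) ↠-refl)
    (↠-⊕ (⟦⟧-↠ πE-hom Q↠u) (↠-constant b (constant-mono c)))
    (↠-⊕ (⟦⟧-↠ πE-hom q̂↠u) (↠-constant b α-mono))
    λ Z → pointwise (πE Z) (α Z)
    where
    -- As c = b + e, this is the sum of r ≤ q̂ + e and u ≤ Q.
    pointwise : ∀ X i → (r X + i) + (u X + b) ≤ (Q X + c) + (q̂ X + i)
    pointwise X i = lin (+-mono-≤ (r≤q̂+e X) (u≤Q X))
      (solve 7 (λ r i u b Q e q →
        ((r :+ i) :+ (u :+ b)) :+ ((q :+ e) :+ Q) := ((Q :+ (b :+ e)) :+ (q :+ i)) :+ (r :+ u))
        refl (r X) i (u X) b (Q X) e (q̂ X))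

  -- The case split is on the term that attains `f₂`, and `f₁` is bounded by its corresponding term.
  f₁≤f₂+f₂+ε : ∀ X i → f₁ X i ≤ f₂ X i + f₂ X i + ε
  f₁≤f₂+f₂+ε X i with ⊓-sel (q̂ X + i) (u X + b)
  ... | inj₁ eq rewrite eq = ≤-trans (m⊓n≤m _ _) (lin (+-mono-≤ (r≤q̂+q̂+ε X) (z≤n {i}))
    (solve 4 (λ r i q ε →
      (r :+ i) :+ (((q :+ q) :+ ε) :+ i) := ((q :+ i :+ (q :+ i)) :+ ε) :+ (r :+ con 0))
      refl (r X) i (q̂ X) ε))
  -- Here c = b + 1 + ε is at most 2b + ε because b ≥ 1.
  ... | inj₂ eq rewrite eq = ≤-trans (m⊓n≤n _ _) (lin (+-mono-≤ (Q≤u+u X) (s≤s (z≤n {n})))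
    (solve 4 (λ Q u ε n →
      (Q :+ (con 1 :+ n :+ (con 1 :+ ε))) :+ ((u :+ u) :+ (con 1 :+ n))
        := ((u :+ (con 1 :+ n) :+ (u :+ (con 1 :+ n))) :+ ε) :+ (Q :+ con 1))
      refl (Q X) (u X) ε n))

  ρN≤ρ₁₁ : ρN ≤′ ρ₁₁
  ρN≤ρ₁₁ Z = ≤-trans (m⊓n≤m _ _) (m⊓n≤m _ _)
  ρN≤ρ₁₂ : ρN ≤′ ρ₁₂
  ρN≤ρ₁₂ Z = ≤-trans (m⊓n≤m (ρ₁₁ Z ⊓ ρ₁₂ Z) _) (m⊓n≤n (ρ₁₁ Z) (ρ₁₂ Z))
  ρN≤ρ₂₁ : ρN ≤′ ρ₂₁
  ρN≤ρ₂₁ Z = ≤-trans (m⊓n≤n (ρ₁₁ Z ⊓ ρ₁₂ Z) _) (m⊓n≤m _ _)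
  ρN≤K : ρN ≤′ constant K
  ρN≤K Z = ≤-trans (m⊓n≤n (ρ₁₁ Z ⊓ ρ₁₂ Z) _) (m⊓n≤n (ρ₂₁ Z) K)

  K+ε : K + ε ≡ d + d
  K+ε = solve 3 (λ d s ε → (d :+ s) :+ ε := d :+ (ε :+ s)) refl d (c + 2) ε

  ρN-submodular : Submodular ρN
  ρN-submodular = bound-⊓
    (bound-⊓ (bound-self ρN≤ρ₁₁ (⊕-submodular φ₁-submodular (⊕-submodular β-submodular γ-submodular)))
             (bound-↠ ρN≤ρ₁₁ ρN≤ρ₁₂ (↠-⊕ φ₁↠φ₂ (↠-⊕ (↠-constant d β-mono) ↠-refl)) sub₁₂)
             (bound-self ρN≤ρ₁₂ sub₁₂))
    (bound-⊓ʳ (bound-sym (bound-⊓ʳ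
        (bound-sym (bound-↠ ρN≤ρ₁₁ ρN≤ρ₂₁ (↠-⊕ φ₁↠φ₂ (↠-⊕ ↠-refl (↠-constant d γ-mono))) sub₂₁))
        (mkBound cross)))
      (bound-sym (bound-⊓ʳ
        (bound-sym (bound-↠ ρN≤ρ₁₁ ρN≤K (↠-constant K mono₁₁) (constant-submodular K)))
        (bound-sym (bound-↠ ρN≤ρ₁₂ ρN≤K (↠-constant K mono₁₂) (constant-submodular K))))))
    (bound-⊓ (bound-self ρN≤ρ₂₁ sub₂₁)
             (bound-↠ ρN≤ρ₂₁ ρN≤K (↠-constant K mono₂₁) (constant-submodular K))
             (bound-self ρN≤K (constant-submodular K)))
    where
    mono₁₁ : Mono ρ₁₁
    mono₁₁ = ⊕-mono φ₁-mono (⊕-mono β-mono γ-mono)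
    mono₁₂ : Mono ρ₁₂
    mono₁₂ = ⊕-mono φ₂-mono (⊕-mono (constant-mono d) γ-mono)
    mono₂₁ : Mono ρ₂₁
    mono₂₁ = ⊕-mono φ₂-mono (⊕-mono β-mono (constant-mono d))
    sub₁₂ : Submodular ρ₁₂
    sub₁₂ = ⊕-submodular φ₂-submodular (⊕-submodular (constant-submodular d) γ-submodular)
    sub₂₁ : Submodular ρ₂₁
    sub₂₁ = ⊕-submodular φ₂-submodular (⊕-submodular β-submodular (constant-submodular d))
    -- The one pair not handled by a quotient. Use `K` at the union and `ρ₁₁` at the intersection;
    -- then φ₁ ≤ 2φ₂ + ε and K + ε = 2d share the total between the two sides.
    cross : ∀ X Y → ρN (X ∪ Y) + ρN (X ∩ Y) ≤ ρ₂₁ X + ρ₁₂ Y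
    cross X Y = begin
      ρN (X ∪ Y) + ρN I
        ≤⟨ +-mono-≤ (ρN≤K (X ∪ Y)) (ρN≤ρ₁₁ I) ⟩
      K + (φ₁ I + (β I + γ I))
        ≤⟨ +-monoʳ-≤ K (+-monoˡ-≤ _ (f₁≤f₂+f₂+ε (πE I) (α I))) ⟩
      K + (φ₂ I + φ₂ I + ε + (β I + γ I))
        ≡⟨ solve 5 (λ K f ε β γ → K :+ (f :+ f :+ ε :+ (β :+ γ)) := (K :+ ε) :+ (f :+ β :+ (f :+ γ)))
             refl K (φ₂ I) ε (β I) (γ I) ⟩
      (K + ε) + (φ₂ I + β I + (φ₂ I + γ I))
        ≡⟨ cong (_+ (φ₂ I + β I + (φ₂ I + γ I))) K+ε ⟩
      (d + d) + (φ₂ I + β I + (φ₂ I + γ I))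
        ≤⟨ +-monoʳ-≤ (d + d) (+-mono-≤
             (+-mono-≤ (mono φ₂-mono I X I⊆X) (mono β-mono I X I⊆X))
             (+-mono-≤ (mono φ₂-mono I Y I⊆Y) (mono γ-mono I Y I⊆Y))) ⟩
      (d + d) + (φ₂ X + β X + (φ₂ Y + γ Y))
        ≡⟨ solve 5 (λ d f β g γ → (d :+ d) :+ (f :+ β :+ (g :+ γ)) := (f :+ (β :+ d)) :+ (g :+ (d :+ γ)))
             refl d (φ₂ X) (β X) (φ₂ Y) (γ Y) ⟩
      ρ₂₁ X + ρ₁₂ Y ∎
      where
      open ≤-Reasoning
      I : Subset size
      I = X ∩ Y
      I⊆X : I ⊆ X
      I⊆X = p∩q⊆p X Y
      I⊆Y : I ⊆ Y
      I⊆Y = p∩q⊆q X Y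

  ρN-mono : Mono ρN
  ρN-mono = ⊓-mono
    (⊓-mono (⊕-mono φ₁-mono (⊕-mono β-mono γ-mono)) (⊕-mono φ₂-mono (⊕-mono (constant-mono d) γ-mono)))
    (⊓-mono (⊕-mono φ₂-mono (⊕-mono β-mono (constant-mono d))) (constant-mono K))

  ρN-bound : ∀ Z → ρN Z ≤ ∣ Z ∣
  ρN-bound Z = begin
    ρN Z                                  ≤⟨ ρN≤ρ₁₁ Z ⟩
    φ₁ Z + (β Z + γ Z)                    ≤⟨ +-monoˡ-≤ (β Z + γ Z) (m⊓n≤m (r (πE Z) + α Z) (Q (πE Z) + c)) ⟩
    r (πE Z) + α Z + (β Z + γ Z)          ≤⟨ +-monoˡ-≤ (β Z + γ Z) (+-monoˡ-≤ (α Z) (rk-bound M (πE Z))) ⟩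
    ∣ πE Z ∣ + α Z + (β Z + γ Z)          ≡⟨ +-assoc ∣ πE Z ∣ (α Z) (β Z + γ Z) ⟩
    ∣ πE Z ∣ + (α Z + (β Z + γ Z))        ≡⟨ cong (λ s → ∣ πE Z ∣ + (α Z + s)) (sym (∣take∣+∣drop∣ d (drop c (drop n Z)))) ⟩
    ∣ πE Z ∣ + (α Z + ∣ drop c (drop n Z) ∣) ≡⟨ cong (∣ πE Z ∣ +_) (sym (∣take∣+∣drop∣ c (drop n Z))) ⟩
    ∣ πE Z ∣ + ∣ drop n Z ∣               ≡⟨ sym (∣take∣+∣drop∣ n Z) ⟩
    ∣ Z ∣                                 ∎
    where open ≤-Reasoning

  N : Matroid size
  N = record { rk = ρN ; rk-bound = ρN-bound ; rk-mono = mono ρN-mono ; rk-submod = bound ρN-submodular }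

  -- Ranks in N of the sets that enter the argument.

  ρ-≥ : ∀ {t l₁ l₂} X i j k → l₁ ≤ f₁ X i → l₂ ≤ f₂ X i → t ≤ l₁ + (j + k) → t ≤ l₂ + (d + k)
      → t ≤ l₂ + (j + d) → t ≤ K → t ≤ ρ X i j k
  ρ-≥ X i j k l₁≤ l₂≤ t₁₁ t₁₂ t₂₁ t≤K = ⊓-glb
    (⊓-glb (≤-trans t₁₁ (+-monoˡ-≤ (j + k) l₁≤)) (≤-trans t₁₂ (+-monoˡ-≤ (d + k) l₂≤)))
    (⊓-glb (≤-trans t₂₁ (+-monoˡ-≤ (j + d) l₂≤)) t≤K)

  ρ-≤₁₁ : ∀ X i j k → ρ X i j k ≤ f₁ X i + (j + k)
  ρ-≤₁₁ X i j k = ≤-trans (m⊓n≤m _ _) (m⊓n≤m _ _)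

  ρ-≤₁₂ : ∀ X i j → ρ X i j 0 ≤ f₂ X i + d
  ρ-≤₁₂ X i j = ≤-trans (≤-trans (m⊓n≤m ((f₁ X i + (j + 0)) ⊓ (f₂ X i + (d + 0))) _) (m⊓n≤n (f₁ X i + (j + 0)) _))
    (≤-reflexive (cong (f₂ X i +_) (+-identityʳ d)))

  ρ-≤₂₁ : ∀ X i k → ρ X i 0 k ≤ f₂ X i + d
  ρ-≤₂₁ X i k = ≤-trans (m⊓n≤n ((f₁ X i + (0 + k)) ⊓ (f₂ X i + (d + k))) _) (m⊓n≤m _ _)

  n≤c : n ≤ c
  n≤c = ≤-trans (n≤1+n n) (m≤m+n b e)

  c+2≤d : c + 2 ≤ d
  c+2≤d = m≤n+m (c + 2) ε

  2+c≤d : 2 + c ≤ d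
  2+c≤d = ≤-trans (≤-reflexive (+-comm 2 c)) c+2≤d

  c≤d : c ≤ d
  c≤d = ≤-trans (m≤n+m c 2) 2+c≤d

  d≤K : d ≤ K
  d≤K = m≤m+n d (c + 2)

  1+b≤c : 1 + b ≤ c
  1+b≤c = ≤-trans (≤-reflexive (+-comm 1 b)) (+-monoʳ-≤ b (s≤s z≤n))

  r≤c : ∀ X → r X ≤ c
  r≤c X = ≤-trans (≤-trans (rk-bound M X) (∣p∣≤n X)) n≤c

  ρ-E : ∀ X → ρ X 0 0 0 ≡ r X
  ρ-E X = ≤-antisym
    (≤-trans (ρ-≤₁₁ X 0 0 0) (≤-trans (≤-reflexive (+-identityʳ (f₁ X 0)))
      (≤-trans (m⊓n≤m (r X + 0) _) (≤-reflexive (+-identityʳ (r X))))))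
    -- `c`, `d` and `K` are all at least r X, so no cap cuts the rank of an old set and 0 is enough
    -- as a bound for `f₂`.
    (ρ-≥ {l₁ = r X} {l₂ = 0} X 0 0 0
      (⊓-glb (m≤m+n (r X) 0) (≤-trans (r≤c X) (m≤n+m c (Q X)))) z≤n
      (m≤m+n (r X) 0) (≤-trans (≤-trans (r≤c X) c≤d) (m≤m+n d 0)) (≤-trans (r≤c X) c≤d)
      (≤-trans (≤-trans (r≤c X) c≤d) d≤K))

  -- With the next two lemmas: after contracting A, F and H have rank at most 1 each and at least 2
  -- together, so they are skew.
  ρ-A≥ : c ≤ ρ ∅ c 0 0
  ρ-A≥ = ρ-≥ {l₁ = c} {l₂ = 0} ∅ c 0 0 (⊓-glb (m≤n+m c (r ∅)) (m≤n+m c (Q ∅))) z≤n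
    (m≤m+n c 0) (≤-trans c≤d (m≤m+n d 0)) c≤d (≤-trans c≤d d≤K)

  ρ-XA≤ : ∀ X → Q X ≤ 1 → ρ X c 0 0 ≤ 1 + c
  ρ-XA≤ X QX≤1 = ≤-trans (ρ-≤₁₁ X c 0 0) (≤-trans (≤-reflexive (+-identityʳ (f₁ X c)))
    (≤-trans (m⊓n≤n (r X + c) _) (+-monoˡ-≤ c QX≤1)))

  ρ-FHA≥ : 2 + c ≤ ρ (F ∪ H) c 0 0
  ρ-FHA≥ = ρ-≥ {l₁ = 2 + c} {l₂ = 0} (F ∪ H) c 0 0
    (⊓-glb (+-monoˡ-≤ c (≤-trans (QFH≥2 H⊈⊥) (Q≤r (F ∪ H)))) (+-monoˡ-≤ c (QFH≥2 H⊈⊥))) z≤n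
    (m≤m+n (2 + c) 0) (≤-trans 2+c≤d (m≤m+n d 0)) 2+c≤d (≤-trans 2+c≤d d≤K)

  -- After contracting B or C, ranks are governed by `f₂`: at most 1 for F, at most `b` for A, and
  -- at least `1 + b` for F ∪ A, so F and A are skew.
  f₂F≤1 : f₂ F 0 ≤ 1
  f₂F≤1 = ≤-trans (m⊓n≤m (q̂ F + 0) _) (≤-trans (≤-reflexive (+-identityʳ (q̂ F))) q̂F≤1)

  f₂A≤b : f₂ ∅ c ≤ b
  f₂A≤b = ≤-trans (m⊓n≤n (q̂ ∅ + c) _) (≤-reflexive (cong (_+ b) u-∅))

  f₂∅≤0 : f₂ ∅ 0 ≤ 0
  f₂∅≤0 = ≤-trans (m⊓n≤m (q̂ ∅ + 0) _) (≤-trans (≤-reflexive (+-identityʳ (q̂ ∅)))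
    (≤-trans (m⊓n≤m (r ∅) (w ∅)) (≤-reflexive rk-⊥)))

  f₂FA≥ : 1 + b ≤ f₂ F c
  f₂FA≥ = ⊓-glb (≤-trans 1+b≤c (m≤n+m c (q̂ F))) (≤-reflexive (cong (_+ b) (sym (off-⊈ ∅ F F⊈∅))))

  f₁FA≥ : 1 + b ≤ f₁ F c
  f₁FA≥ = ⊓-glb (≤-trans 1+b≤c (m≤n+m c (r F))) (≤-trans 1+b≤c (m≤n+m c (Q F)))

  1+b+d≤K : 1 + b + d ≤ K
  1+b+d≤K = ≤-trans (≤-reflexive (+-comm (1 + b) d)) (+-monoʳ-≤ d (≤-trans 1+b≤c (m≤m+n c 2)))

  ρ-FAB≥ : 1 + b + d ≤ ρ F c d 0
  ρ-FAB≥ = ρ-≥ F c d 0 f₁FA≥ f₂FA≥ (+-monoʳ-≤ (1 + b) (m≤m+n d 0)) (+-monoʳ-≤ (1 + b) (m≤m+n d 0))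
    (+-monoʳ-≤ (1 + b) (m≤m+n d d)) 1+b+d≤K

  ρ-FAC≥ : 1 + b + d ≤ ρ F c 0 d
  ρ-FAC≥ = ρ-≥ F c 0 d f₁FA≥ f₂FA≥ ≤-refl (+-monoʳ-≤ (1 + b) (m≤m+n d d)) ≤-refl 1+b+d≤K

  ρ-B≥ : d ≤ ρ ∅ 0 d 0
  ρ-B≥ = ρ-≥ {l₁ = 0} {l₂ = 0} ∅ 0 d 0 z≤n z≤n (m≤m+n d 0) (m≤m+n d 0) (m≤m+n d d) d≤K

  ρ-C≥ : d ≤ ρ ∅ 0 0 d
  ρ-C≥ = ρ-≥ {l₁ = 0} {l₂ = 0} ∅ 0 0 d z≤n z≤n ≤-refl (m≤m+n d d) ≤-refl d≤K

  K≤d+d : K ≤ d + d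
  K≤d+d = ≤-trans (m≤m+n K ε) (≤-reflexive K+ε)

  ρ-BC≥ : K ≤ ρ ∅ 0 d d
  ρ-BC≥ = ρ-≥ {l₁ = 0} {l₂ = 0} ∅ 0 d d z≤n z≤n K≤d+d K≤d+d K≤d+d ≤-refl

  -- Every set in the argument consists of old elements and whole blocks, so one side per block
  -- suffices and unions are computed sidewise.
  blk : Subset n → Side → Side → Side → Subset size
  blk X s t v = block X (replicate c s) (replicate d t) (replicate d v)

  weight : ℕ → Side → ℕ
  weight k s = if s then k else 0

  ∣replicate∣ : ∀ k s → ∣ replicate k s ∣ ≡ weight k s
  ∣replicate∣ k inside = ∣⊤∣≡n k
  ∣replicate∣ k outside = ∣⊥∣≡0 k

  pad-blk : ∀ X → pad (c + (d + d)) X ≡ blk X outside outside outside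
  pad-blk X = cong (X ++_) (trans (sym (⊥-++ c)) (cong (⊥ {c} ++_) (sym (⊥-++ {d} d))))

  rk-blk : ∀ X s t v → ρN (blk X s t v) ≡ ρ X (weight c s) (weight d t) (weight d v)
  rk-blk X s t v = ρ-cong
    (take-++ X _)
    (trans (cong ∣_∣ (trans (cong (take c) drop-E) (take-++ (replicate c s) _))) (∣replicate∣ c s))
    (trans (cong ∣_∣ (trans (cong (take d) drop-A) (take-++ (replicate d t) _))) (∣replicate∣ d t))
    (trans (cong ∣_∣ (trans (cong (drop d) drop-A) (drop-++ (replicate d t) _))) (∣replicate∣ d v))
    where
    ρ-cong : ∀ {X X′ i i′ j j′ k k′} → X ≡ X′ → i ≡ i′ → j ≡ j′ → k ≡ k′ → ρ X i j k ≡ ρ X′ i′ j′ k′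
    ρ-cong refl refl refl refl = refl
    drop-E : drop n (blk X s t v) ≡ replicate c s ++ (replicate d t ++ replicate d v)
    drop-E = drop-++ X _
    drop-A : drop c (drop n (blk X s t v)) ≡ replicate d t ++ replicate d v
    drop-A = trans (cong (drop c) drop-E) (drop-++ (replicate c s) _)

  blk-∪ : ∀ X s t v X′ s′ t′ v′ → blk X s t v ∪ blk X′ s′ t′ v′ ≡ blk (X ∪ X′) (s ∨ s′) (t ∨ t′) (v ∨ v′)
  blk-∪ X s t v X′ s′ t′ v′ = trans (∪-++ X _ X′ _) (cong ((X ∪ X′) ++_)
    (trans (∪-++ (replicate c s) _ (replicate c s′) _) (cong₂ _++_ (∪-replicate c s s′)
    (trans (∪-++ (replicate d t) _ (replicate d t′) _) (cong₂ _++_ (∪-replicate d t t′) (∪-replicate d v v′))))))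

  N-extends : IsExtension M N
  N-extends X = trans (cong ρN (pad-blk X)) (trans (rk-blk X outside outside outside) (ρ-E X))

  -- The common span of F and H in an arbitrary extension of N.

  module _ (hyper : r (F ∪ H) ≤ 1 + r H) {k′ : ℕ} (N′ : Matroid (size + k′)) (ext : IsExtension N N′) where

    module R′ = Rank N′
    r′ : Subset (size + k′) → ℕ
    r′ = rk N′

    G : Subset n → Side → Side → Side → Subset (size + k′)
    G X s t v = pad k′ (blk X s t v)

    r′-G : ∀ X s t v → r′ (G X s t v) ≡ ρ X (weight c s) (weight d t) (weight d v)
    r′-G X s t v = trans (ext (blk X s t v)) (rk-blk X s t v)

    G-∪ : ∀ X s t v X′ s′ t′ v′ → G X s t v ∪ G X′ s′ t′ v′ ≡ G (X ∪ X′) (s ∨ s′) (t ∨ t′) (v ∨ v′)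
    G-∪ X s t v X′ s′ t′ v′ = trans (pad-∪ k′ (blk X s t v) (blk X′ s′ t′ v′)) (cong (pad k′) (blk-∪ X s t v X′ s′ t′ v′))

    FS HS AS BS CS : Subset (size + k′)
    FS = G F outside outside outside
    HS = G H outside outside outside
    AS = G ∅ inside outside outside
    BS = G ∅ outside inside outside
    CS = G ∅ outside outside inside

    G-∪-∅ : ∀ X s t v s′ t′ v′ → G X s t v ∪ G ∅ s′ t′ v′ ≡ G X (s ∨ s′) (t ∨ t′) (v ∨ v′)
    G-∪-∅ X s t v s′ t′ v′ = trans (G-∪ X s t v ∅ s′ t′ v′)
      (cong (λ Y → G Y (s ∨ s′) (t ∨ t′) (v ∨ v′)) (∪-identityʳ X))

    r′-∪ : ∀ X s t v s′ t′ v′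
         → r′ (G X s t v ∪ G ∅ s′ t′ v′) ≡ ρ X (weight c (s ∨ s′)) (weight d (t ∨ t′)) (weight d (v ∨ v′))
    r′-∪ X s t v s′ t′ v′ = trans (cong r′ (G-∪-∅ X s t v s′ t′ v′)) (r′-G X (s ∨ s′) (t ∨ t′) (v ∨ v′))

    module _ {L : Subset (size + k′)} (spanF : R′.Spans FS L) (spanH : R′.Spans HS L) where

      -- The balance (1 + c) + (1 + c) = (2 + c) + c leaves A ∪ L with rank at most `c`, which A
      -- already has.
      spanA : R′.Spans AS L
      spanA = ≤-trans
        (R′.skew spanF spanH
          (≤-trans (≤-reflexive (r′-∪ F outside outside outside inside outside outside)) (ρ-XA≤ F QF≤1))
          (≤-trans (≤-reflexive (r′-∪ H outside outside outside inside outside outside)) (ρ-XA≤ H QH≤1))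
          (≤-trans ρ-FHA≥ (≤-reflexive (sym (trans
            (cong (λ S → r′ (S ∪ AS)) (G-∪ F outside outside outside H outside outside outside))
            (r′-∪ (F ∪ H) outside outside outside inside outside outside)))))
          (≤-reflexive (solve 1 (λ c → (con 1 :+ c) :+ (con 1 :+ c) := (con 2 :+ c) :+ c) refl c)))
        (≤-trans ρ-A≥ (≤-reflexive (sym (r′-G ∅ inside outside outside))))

      -- B and C play symmetric roles, so `t` and `v` select the block. Now F and A are the two skew
      -- sets spanning L.
      spanBC : ∀ t v → ρ F 0 (weight d t) (weight d v) ≤ 1 + d → ρ ∅ c (weight d t) (weight d v) ≤ b + d
             → 1 + b + d ≤ ρ F c (weight d t) (weight d v) → d ≤ ρ ∅ 0 (weight d t) (weight d v)
             → R′.Spans (G ∅ outside t v) L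
      spanBC t v F≤ A≤ FA≥ d≤ = ≤-trans
        (R′.skew spanF spanA
          (≤-trans (≤-reflexive (r′-∪ F outside outside outside outside t v)) F≤)
          (≤-trans (≤-reflexive (r′-∪ ∅ inside outside outside outside t v)) A≤)
          (≤-trans FA≥ (≤-reflexive (sym (trans
            (cong (λ S → r′ (S ∪ G ∅ outside t v)) (G-∪-∅ F outside outside outside inside outside outside))
            (r′-∪ F inside outside outside outside t v)))))
          (≤-reflexive (solve 2 (λ b d → (con 1 :+ d) :+ (b :+ d) := (con 1 :+ b :+ d) :+ d) refl b d)))
        (≤-trans d≤ (≤-reflexive (sym (r′-G ∅ outside t v))))

      spanB : R′.Spans BS L
      spanB = spanBC inside outside
        (≤-trans (ρ-≤₁₂ F 0 d) (+-monoˡ-≤ d f₂F≤1)) (≤-trans (ρ-≤₁₂ ∅ c d) (+-monoˡ-≤ d f₂A≤b)) ρ-FAB≥ ρ-B≥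

      spanC : R′.Spans CS L
      spanC = spanBC outside inside
        (≤-trans (ρ-≤₂₁ F 0 d) (+-monoˡ-≤ d f₂F≤1)) (≤-trans (ρ-≤₂₁ ∅ c d) (+-monoˡ-≤ d f₂A≤b)) ρ-FAC≥ ρ-C≥

      r′L≤ε : r′ L ≤ ε
      r′L≤ε = ≤-trans (rk-mono N′ L _ (q⊆p∪q (G ∅ outside outside outside) L))
        -- Nothing is contracted here: B and C both span L, and the defect 2d - K = ε bounds its
        -- rank.
        (R′.skew spanB spanC
          (≤-trans (≤-reflexive (r′-∪ ∅ outside inside outside outside outside outside))
            (≤-trans (ρ-≤₁₂ ∅ 0 d) (+-monoˡ-≤ d f₂∅≤0)))
          (≤-trans (≤-reflexive (r′-∪ ∅ outside outside inside outside outside outside))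
            (≤-trans (ρ-≤₂₁ ∅ 0 d) (+-monoˡ-≤ d f₂∅≤0)))
          (≤-trans ρ-BC≥ (≤-reflexive (sym (trans
            (cong (λ S → r′ (S ∪ G ∅ outside outside outside)) (G-∪-∅ ∅ outside inside outside outside outside inside))
            (r′-∪ ∅ outside inside inside outside outside outside)))))
          (≤-reflexive (sym K+ε)))

    r′-E : ∀ X → r′ (G X outside outside outside) ≡ r X
    r′-E X = trans (r′-G X outside outside outside) (ρ-E X)

    not-modular : ¬ ModularPair N′ (cl N′ FS) (cl N′ HS)
    not-modular modular = <⇒≱ ε<r′L (r′L≤ε spanF spanH)
      where
      L U : Subset (size + k′)
      L = cl N′ FS ∩ cl N′ HS
      U = cl N′ FS ∪ cl N′ HS
      spanF : R′.Spans FS L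
      spanF = R′.spans-⊆ (p∩q⊆p (cl N′ FS) (cl N′ HS)) (R′.cl-spans FS)
      spanH : R′.Spans HS L
      spanH = R′.spans-⊆ (p∩q⊆q (cl N′ FS) (cl N′ HS)) (R′.cl-spans HS)
      -- Modularity would give L rank at least r F + r H - r (F ∪ H), and r (F ∪ H) is at most 1 + r
      -- H.
      ε<r′L : suc ε ≤ r′ L
      ε<r′L = +-cancelʳ-≤ (1 + r H) (suc ε) (r′ L) (begin
        suc ε + (1 + r H)            ≡⟨ +-suc (suc ε) (r H) ⟩
        2 + ε + r H                  ≡⟨ cong (_+ r H) (sym rkF) ⟩
        r F + r H                    ≡⟨ sym (cong₂ _+_ (r′-E F) (r′-E H)) ⟩
        r′ FS + r′ HS                ≤⟨ +-mono-≤ (rk-mono N′ _ _ (R′.⊆cl FS)) (rk-mono N′ _ _ (R′.⊆cl HS)) ⟩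
        r′ (cl N′ FS) + r′ (cl N′ HS) ≡⟨ modular ⟩
        -- Enlarging U by FS ∪ HS brings it to the form of `Spans`, so that both closures collapse
        -- to FS ∪ HS.
        r′ U + r′ L                  ≤⟨ +-monoˡ-≤ (r′ L) (rk-mono N′ U ((FS ∪ HS) ∪ U) (q⊆p∪q (FS ∪ HS) U)) ⟩
        r′ ((FS ∪ HS) ∪ U) + r′ L    ≤⟨ +-monoˡ-≤ (r′ L) (R′.spans-∪
                                          (R′.spans-⊇ (p⊆p∪q HS) (R′.cl-spans FS))
                                          (R′.spans-⊇ (q⊆p∪q FS HS) (R′.cl-spans HS))) ⟩
        r′ (FS ∪ HS) + r′ L          ≡⟨ cong (_+ r′ L) (trans (cong r′ (G-∪ F outside outside outside H outside outside outside)) (r′-E (F ∪ H))) ⟩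
        r (F ∪ H) + r′ L             ≤⟨ +-monoˡ-≤ (r′ L) hyper ⟩
        1 + r H + r′ L               ≡⟨ +-comm (1 + r H) (r′ L) ⟩
        r′ L + (1 + r H)             ∎)
        where open ≤-Reasoning

-- Reduction to F of rank at least two, and conclusion.

-- If r F ≤ 1 the pair is modular: either F ⊆ H, or F ∪ H leaves the flat H and gains rank.
rank≥2 : (M : Matroid n) (F H : Subset n) → IsFlat M H → Empty (F ∩ H) → ¬ ModularPair M F H → 2 ≤ rk M F
rank≥2 {n} M F H flatH disjoint nonmodular = ≰⇒> λ rF≤1 → nonmodular (≤-antisym (upper rF≤1) (rk-submod M F H))
  where
  open Rank M
  open ≤-Reasoning
  upper : rk M F ≤ 1 → rk M F + rk M H ≤ rk M (F ∪ H) + rk M (F ∩ H)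
  upper rF≤1 with F ⊆? H
  ... | yes F⊆H = begin
    rk M F + rk M H              ≡⟨ +-comm (rk M F) (rk M H) ⟩
    rk M H + rk M F              ≤⟨ +-mono-≤ (rk-mono M H (F ∪ H) (q⊆p∪q F H)) (rk-mono M F (F ∩ H) (∩-glb ⊆-refl F⊆H)) ⟩
    rk M (F ∪ H) + rk M (F ∩ H)  ∎
  ... | no F⊈H = begin
    rk M F + rk M H              ≤⟨ +-monoˡ-≤ (rk M H) rF≤1 ⟩
    1 + rk M H                   ≤⟨ flat-< flatH ⊆-refl (λ p → F⊈H (p ∘ p⊆p∪q H)) (q⊆p∪q F H) ⟩
    rk M (F ∪ H)                 ≤⟨ m≤m+n (rk M (F ∪ H)) (rk M (F ∩ H)) ⟩
    rk M (F ∪ H) + rk M (F ∩ H)  ∎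

theorem8 : ∀ (n : ℕ) (M : Matroid n) (F H : Subset n)
    → IsFlat M F → IsHyperplane M H → Empty (F ∩ H) → ¬ ModularPair M F H
    → Σ ℕ λ k → Σ (Matroid (n + k)) λ N → IsExtension M N
    × (∀ (k′ : ℕ) (N′ : Matroid (n + k + k′)) → IsExtension N N′
    → ¬ ModularPair N′ (cl N′ (pad k′ (pad k F))) (cl N′ (pad k′ (pad k H))))
theorem8 n M F H flatF (flatH , rkH) disjoint nonmodular =
  c + (d + d) , N , N-extends , λ k′ N′ ext →
    subst₂ (λ S T → ¬ ModularPair N′ (cl N′ S) (cl N′ T))
      (cong (pad k′) (sym (pad-blk F))) (cong (pad k′) (sym (pad-blk H)))
      (not-modular (≤-trans (rk-mono M (F ∪ H) ⊤ ⊆⊤) (≤-reflexive (sym rkH))) N′ ext)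
  where
  2≤rF : 2 ≤ rk M F
  2≤rF = rank≥2 M F H flatH disjoint nonmodular
  H⊈⊥ : ¬ (H ⊆ ⊥)
  -- With H empty, the hyperplane condition would give M rank 1, below the rank of F.
  H⊈⊥ H⊆⊥ = <⇒≱ 2≤rF (begin
    rk M F        ≤⟨ rk-mono M F ⊤ ⊆⊤ ⟩
    rk M ⊤        ≡⟨ sym rkH ⟩
    1 + rk M H    ≤⟨ s≤s (≤-trans (rk-mono M H ⊥ H⊆⊥) (≤-reflexive (Rank.rk-⊥ M))) ⟩
    1             ∎)
    where open ≤-Reasoning
  -- Here ε is fixed as r F - 2; the bound r F ≥ 2 excludes truncation.
  open Construction M F H flatF flatH disjoint (rk M F ∸ 2) (sym (m+[n∸m]≡n 2≤rF)) H⊈⊥
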